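{- Let $p$ be a program, let $\psi$ be a first-order formula in $\mathcal{L}=\{0,1,+,-,\cdot,\leq\}$ whose free variables are program variables, let $\exists \overline{X}\, \pi$ be the linear Horn formula equation $\exists X_0\, \mathrm{vc}(\{X_0\}p\{\psi\})$, and let $\nu = \neg [\mathrm{lfp}_{X_0}\,\Phi_{\pi^D}]$. Then $[\nu] = \mathrm{wp}(p,\psi)$.
   Context: Language and programs: $\mathcal{L}=\{0,1,+,-,\cdot,\leq\}$ is the first-order language of arithmetic (with equality) and $\mathbb{Z}$ its standard model on the integers. Let $x_1,\ldots,x_k$ be the program variables. Programs are given by $$p ::= \textbf{skip} \mid x_j := t \mid p_0;p_1 \mid \textbf{if } B \textbf{ then } p_0 \textbf{ else } p_1 \mid \textbf{while } B \textbf{ do } p_0,$$ with $t$ an $\mathcal{L}$-term and $B$ a quantifier-free $\mathcal{L}$-formula, both over the program variables. A state is a map from $\{x_1,\ldots,x_k\}$ to $\mathbb{Z}$; $\Sigma$ is the set of states. $C(p)$ is the usual denotational semantics of $p$, a partial function $\Sigma\to\Sigma$ (undefined on non-terminating runs). Weakest (liberal) precondition: $\mathrm{wp}(p,\psi)=\{\sigma\in\Sigma\mid \mathbb{Z},C(p)(\sigma)\models\psi\}$, where the condition counts as satisfied if $C(p)(\sigma)$ is undefined (partial correctness). For a formula $\theta$ all of whose free variables are program variables, $[\theta]=\{\sigma\in\Sigma\mid\mathbb{Z},\sigma\models\theta\}$; for a $k$-ary predicate $\nu$, $[\nu]=[\nu(x_1,\ldots,x_k)]$. Verification condition: $\mathrm{vc}(\{\varphi\}p\{\psi\})=\exists\overline{I}\,\forall^*\,\widetilde{\mathrm{vc}}(\{\varphi\}p\{\psi\})$,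 where $\forall^*$ is universal closure over individual variables, $\overline{I}$ are the fresh predicate variables introduced in (3) and (5) below, and $\widetilde{\mathrm{vc}}$ is defined (also for $\varphi,\psi$ containing predicate variables) by recursion on $p$: (1) $\widetilde{\mathrm{vc}}(\{\varphi\}\textbf{skip}\{\psi\})=\varphi\to\psi$; (2) $\widetilde{\mathrm{vc}}(\{\varphi\}x_j:=t\{\psi\})=\varphi\to\psi[x_j\backslash t]$; (3) $\widetilde{\mathrm{vc}}(\{\varphi\}p_0;p_1\{\psi\})=\widetilde{\mathrm{vc}}(\{\varphi\}p_0\{I\})\land\widetilde{\mathrm{vc}}(\{I\}p_1\{\psi\})$; (4) $\widetilde{\mathrm{vc}}(\{\varphi\}\textbf{if }B\textbf{ then }p_0\textbf{ else }p_1\{\psi\})=\widetilde{\mathrm{vc}}(\{\varphi\land B\}p_0\{\psi\})\land\widetilde{\mathrm{vc}}(\{\varphi\land\neg B\}p_1\{\psi\})$; (5) $\widetilde{\mathrm{vc}}(\{\varphi\}\textbf{while }B\textbf{ do }p_0\{\psi\})=\widetilde{\mathrm{vc}}(\{I\land B\}p_0\{I\})\land(\varphi\to I)\land(I\land\neg B\to\psi)$. In (3) and (5), $I$ is a fresh $k$-ary predicate variable (distinct from all others used), abbreviating the atom $I(x_1,\ldots,x_k)$, so $I[x_j\backslash t]$ is $I(x_1,\ldots,t,\ldots,x_k)$. Likewise $X_0$ is a $k$-ary predicate variable abbreviating $X_0(x_1,\ldots,x_k)$. Thus $\exists X_0\,\mathrm{vc}(\{X_0\}p\{\psi\})$ is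 $\exists\overline{X}\,\pi$ with $\overline{X}=(X_0,\overline{I})=(X_0,X_1,\ldots,X_n)$ and $\pi=\forall^*\,\widetilde{\mathrm{vc}}(\{X_0\}p\{\psi\})$. Linear Horn form and dualisation: every conjunct of $\pi$ is an implication whose premise is a conjunction of first-order formulas and at most one predicate-variable atom and whose conclusion is a predicate-variable atom or a first-order formula; a conjunct $A\to\theta$ with $\theta$ first-order is read as $A\land\neg\theta\to\bot$. So $\pi$ is a conjunction of clauses of the forms $\varphi'\land X_i(\overline{t})\to X_j(\overline{s})$, $\varphi'\to X_j(\overline{s})$, $\varphi'\land X_i(\overline{t})\to\bot$, $\varphi'\to\bot$ with $\varphi'$ first-order without predicate variables (a linear Horn formula equation). $\pi^D$ is $\pi[X_0\backslash\neg X_0,\ldots,X_n\backslash\neg X_n]$, written as a conjunction of constrained Horn clauses by contraposition: these clauses become, respectively, $\varphi'\land X_j(\overline{s})\to X_i(\overline{t})$, $\varphi'\land X_j(\overline{s})\to\bot$, $\varphi'\to X_i(\overline{t})$, $\varphi'\to\bot$. Least fixed points: for a tuple $\Phi=(\varphi_i(X_0,\ldots,X_n,\overline{u_i}))_{i=0}^n$ of formulas in which the $X_j$ occur only positively, with $|\overline{u_i}|=k_i$ the arity of $X_i$, and a structure $\mathcal{M}$ with domain $M$, let $F_\Phi=(F_0,\ldots,F_n)$ on $\mathcal{P}(M^{k_0})\times\cdots\times\mathcal{P}(M^{k_n})$, $F_i(R_0,\ldots,R_n)=\{\overline{a}\in M^{k_i}\mid \mathcal{M}\models\varphi_i(R_0,\ldots,R_n,\overline{a})\}$.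 This is monotone; $[\mathrm{lfp}_{X_i}\,\Phi]$ is interpreted in $\mathcal{M}$ as the $X_i$-component of the least fixed point of $F_\Phi$, and $\neg[\mathrm{lfp}_{X_i}\,\Phi]$ as its complement. The tuple $\Phi_\theta$ for a conjunction $\theta$ of constrained Horn clauses in $X_0,\ldots,X_n$ (applied to $\theta=\pi^D$): let $B_j$ be the set of clauses of $\theta$ of the form $\varphi'\to X_j(\overline{s})$, written $(\varphi',\overline{s})$, and $\mathrm{Ind}_j$ the set of clauses $\varphi'\land X_{i_1}(\overline{t_1})\land\cdots\land X_{i_m}(\overline{t_m})\to X_j(\overline{s})$ with $m\ge1$, written $(\varphi',\iota,\tau,\overline{s})$, $\iota=(i_1,\ldots,i_m)$, $\tau=(\overline{t_1},\ldots,\overline{t_m})$. Then $\Phi_\theta=(\varphi_j(X_0,\ldots,X_n,\overline{z_j}))_{j=0}^n$, where $\varphi_j$ is $$\exists \overline{y}\left(\bigvee_{(\varphi',\overline{s})\in B_j}(\varphi'\land\overline{z_j}=\overline{s})\lor\bigvee_{(\varphi',\iota,\tau,\overline{s})\in \mathrm{Ind}_j}\Big(\varphi'\land\bigwedge_{l=1}^m X_{i_l}(\overline{t_l})\land\overline{z_j}=\overline{s}\Big)\right),$$ $\overline{y}$ being the free variables of the clauses in $B_j\cup \mathrm{Ind}_j$ and $\overline{z_j}$ fresh variables, as many as the arity of $X_j$ (empty disjunctions are false). -}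

module Defs where

open import Data.Empty using (⊥; ⊥-elim)
open import Data.Fin.Base using (Fin; zero; suc; _↑ˡ_; _↑ʳ_)
open import Data.Fin.Properties using (_≟_)
open import Data.Integer.Base as ℤ using (ℤ; 0ℤ; 1ℤ)
open import Data.List.Base as List using (List; []; _∷_; foldr; mapMaybe; fromMaybe)
open import Data.List.Membership.Propositional using (_∈_)
open import Data.List.Relation.Unary.All as All using (All; []; _∷_)
open import Data.List.Relation.Unary.Any using (here; there)
open import Data.Maybe.Base as Maybe using (Maybe; just; nothing)
open import Data.Nat.Base using (ℕ; zero; suc; _+_)
open import Data.Product.Base using (Σ-syntax; ∃-syntax; _×_; _,_; proj₁; proj₂)
open import Data.Unit.Base using (⊤; tt)
open import Data.Vec.Base as Vec using (Vec; []; _∷_; _++_; tabulate; lookup; _[_]≔_)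
open import Data.Vec.Properties
  using (lookup-map; map-∘; map-cong; tabulate-∘; tabulate-cong; tabulate∘lookup; lookup-++ˡ; lookup-++ʳ)
open import Function.Base using (_∘_)
open import Level using (0ℓ)
open import Relation.Binary.PropositionalEquality
  using (_≡_; refl; sym; trans; cong; cong₂; subst; subst₂)
open import Relation.Nullary using (¬_; yes; no)
open import Relation.Unary using (Pred; _⊆_; _≐_; ∁)

-- Individual variables are de Bruijn indices: a term over `n` variables
-- uses `var i` with `i : Fin n`.

infixl 6 _⊕_ _⊖_
infixl 7 _⊛_

data Term (n : ℕ) : Set where
  var         : Fin n → Term n
  `0 `1       : Term n
  _⊕_ _⊖_ _⊛_ : Term n → Term n → Term n

vars : ∀ {n} → Vec (Term n) n
vars = tabulate var

-- Disjunction and existential quantification are the de Morgan duals of the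
-- primitive connectives.  First-order satisfaction in ℤ, given by the Tarski
-- clauses, is thereby stable under double negation, i.e. it is classical
-- satisfaction although the metatheory is constructive.

infix  9 _`=_ _`≤_
infixr 8 `∀_
infixr 7 _`∧_
infixr 5 _⇒_

data Formula {P : ℕ} (ar : Fin P → ℕ) (n : ℕ) : Set where
  _`=_ _`≤_ : Term n → Term n → Formula ar n
  X         : (i : Fin P) → Vec (Term n) (ar i) → Formula ar n
  `⊥        : Formula ar n
  _`∧_ _⇒_  : Formula ar n → Formula ar n → Formula ar n
  `∀_       : Formula ar (suc n) → Formula ar n

module _ {P : ℕ} {ar : Fin P → ℕ} where

  infixr 8 ∼_ `∃_
  infixr 6 _`∨_

  ∼_ : ∀ {n} → Formula ar n → Formula ar n
  ∼ A = A ⇒ `⊥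

  `⊤ : ∀ {n} → Formula ar n
  `⊤ = ∼ `⊥

  _`∨_ : ∀ {n} → Formula ar n → Formula ar n → Formula ar n
  A `∨ B = ∼ (∼ A `∧ ∼ B)

  `∃_ : ∀ {n} → Formula ar (suc n) → Formula ar n
  `∃ A = ∼ (`∀ ∼ A)

  ⋁ : ∀ {n} → List (Formula ar n) → Formula ar n
  ⋁ = foldr _`∨_ `⊥

  ∃* : ∀ m {n} → Formula ar (m + n) → Formula ar n
  ∃* zero    A = A
  ∃* (suc m) A = ∃* m (`∃ A)

  ∀* : ∀ {n} → Formula ar n → Formula ar 0
  ∀* {zero}  A = A
  ∀* {suc n} A = ∀* (`∀ A)

no-predicates : Fin 0 → ℕ
no-predicates ()

FO : ℕ → Set
FO = Formula no-predicates

embed : ∀ {P} {ar : Fin P → ℕ} {n} → FO n → Formula ar n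
embed (s `= t)  = s `= t
embed (s `≤ t)  = s `≤ t
embed `⊥        = `⊥
embed (A `∧ B)  = embed A `∧ embed B
embed (A ⇒ B)   = embed A ⇒ embed B
embed (`∀ A)    = `∀ embed A

QuantifierFree : ∀ {P} {ar : Fin P → ℕ} {n} → Formula ar n → Set
QuantifierFree (s `= t) = ⊤
QuantifierFree (s `≤ t) = ⊤
QuantifierFree (X i ts) = ⊤
QuantifierFree `⊥       = ⊤
QuantifierFree (A `∧ B) = QuantifierFree A × QuantifierFree B
QuantifierFree (A ⇒ B)  = QuantifierFree A × QuantifierFree B
QuantifierFree (`∀ A)   = ⊥

substᵗ : ∀ {m n} → Vec (Term n) m → Term m → Term n
substᵗ σ (var i) = lookup σ i
substᵗ σ `0      = `0
substᵗ σ `1      = `1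
substᵗ σ (s ⊕ t) = substᵗ σ s ⊕ substᵗ σ t
substᵗ σ (s ⊖ t) = substᵗ σ s ⊖ substᵗ σ t
substᵗ σ (s ⊛ t) = substᵗ σ s ⊛ substᵗ σ t

weaken : ∀ {n} → Term n → Term (suc n)
weaken = substᵗ (tabulate (var ∘ suc))

lift : ∀ {m n} → Vec (Term n) m → Vec (Term (suc n)) (suc m)
lift σ = var zero ∷ Vec.map weaken σ

substᶠ : ∀ {P} {ar : Fin P → ℕ} {m n} →
         Vec (Term n) m → Formula ar m → Formula ar n
substᶠ σ (s `= t) = substᵗ σ s `= substᵗ σ t
substᶠ σ (s `≤ t) = substᵗ σ s `≤ substᵗ σ t
substᶠ σ (X i ts) = X i (Vec.map (substᵗ σ) ts)
substᶠ σ `⊥       = `⊥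
substᶠ σ (A `∧ B) = substᶠ σ A `∧ substᶠ σ B
substᶠ σ (A ⇒ B)  = substᶠ σ A ⇒ substᶠ σ B
substᶠ σ (`∀ A)   = `∀ substᶠ (lift σ) A

infixl 10 _[_╲_]

_[_╲_] : ∀ {P} {ar : Fin P → ℕ} {n} →
         Formula ar n → Fin n → Term n → Formula ar n
A [ j ╲ t ] = substᶠ (vars [ j ]≔ t) A

⟦_⟧ : ∀ {n} → Term n → Vec ℤ n → ℤ
⟦ var i ⟧ ρ = lookup ρ i
⟦ `0 ⟧    ρ = 0ℤ
⟦ `1 ⟧    ρ = 1ℤ
⟦ s ⊕ t ⟧ ρ = ⟦ s ⟧ ρ ℤ.+ ⟦ t ⟧ ρ
⟦ s ⊖ t ⟧ ρ = ⟦ s ⟧ ρ ℤ.- ⟦ t ⟧ ρ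
⟦ s ⊛ t ⟧ ρ = ⟦ s ⟧ ρ ℤ.* ⟦ t ⟧ ρ

⟦_⟧* : ∀ {m n} → Vec (Term n) m → Vec ℤ n → Vec ℤ m
⟦ ts ⟧* ρ = Vec.map (λ t → ⟦ t ⟧ ρ) ts

Relations : ∀ {P} → (Fin P → ℕ) → Set₁
Relations ar = ∀ i → Pred (Vec ℤ (ar i)) 0ℓ

infix 4 _,_⊨_ _⊨_

_,_⊨_ : ∀ {P} {ar : Fin P → ℕ} {n} →
        Relations ar → Vec ℤ n → Formula ar n → Set
R , ρ ⊨ s `= t = ⟦ s ⟧ ρ ≡ ⟦ t ⟧ ρ
R , ρ ⊨ s `≤ t = ⟦ s ⟧ ρ ℤ.≤ ⟦ t ⟧ ρ
R , ρ ⊨ X i ts = R i (⟦ ts ⟧* ρ)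
R , ρ ⊨ `⊥     = ⊥
R , ρ ⊨ A `∧ B = (R , ρ ⊨ A) × (R , ρ ⊨ B)
R , ρ ⊨ A ⇒ B  = R , ρ ⊨ A → R , ρ ⊨ B
R , ρ ⊨ `∀ A   = ∀ a → R , (a ∷ ρ) ⊨ A

_⊨_ : ∀ {n} → Vec ℤ n → FO n → Set
ρ ⊨ A = (λ ()) , ρ ⊨ A

infixr 4 _⨾_
infix  5 _≔_

data Program (k : ℕ) : Set where
  skip  : Program k
  _≔_   : Fin k → Term k → Program k
  _⨾_   : Program k → Program k → Program k
  if    : (B : FO k) {qf : QuantifierFree B} → Program k → Program k → Program k
  while : (B : FO k) {qf : QuantifierFree B} → Program k → Program k

State : ℕ → Set
State k = Vec ℤ k

infix 3 _⇀_

record _⇀_ (A B : Set) : Set₁ where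
  field
    graph      : A → B → Set
    functional : ∀ {a b b′} → graph a b → graph a b′ → b ≡ b′

open _⇀_ public

module _ {S : Set} where

  id⇀ : S ⇀ S
  id⇀ .graph      s s′      = s′ ≡ s
  id⇀ .functional refl refl = refl

  total : (S → S) → S ⇀ S
  total f .graph      s s′      = s′ ≡ f s
  total f .functional refl refl = refl

  _then_ : S ⇀ S → S ⇀ S → S ⇀ S
  (f then g) .graph s s″ = ∃[ s′ ] graph f s s′ × graph g s′ s″
  (f then g) .functional (_ , fs , gs) (_ , fs′ , gs′)
    with refl ← functional f fs fs′ = functional g gs gs′

  data Branch (T : Pred S 0ℓ) (f g : S ⇀ S) : S → S → Set where
    true  : ∀ {s s′} → T s   → graph f s s′ → Branch T f g s s′
    false : ∀ {s s′} → ¬ T s → graph g s s′ → Branch T f g s s′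

  branch : Pred S 0ℓ → S ⇀ S → S ⇀ S → S ⇀ S
  branch T f g .graph = Branch T f g
  branch T f g .functional (true _ x)  (true _ y)  = functional f x y
  branch T f g .functional (true t _)  (false n _) = ⊥-elim (n t)
  branch T f g .functional (false n _) (true t _)  = ⊥-elim (n t)
  branch T f g .functional (false _ x) (false _ y) = functional g x y

  data Iterate (T : Pred S 0ℓ) (f : S ⇀ S) : S → S → Set where
    stop : ∀ {s} → ¬ T s → Iterate T f s s
    step : ∀ {s s′ s″} → T s → graph f s s′ → Iterate T f s′ s″ → Iterate T f s s″

  iterate : Pred S 0ℓ → S ⇀ S → S ⇀ S
  iterate T f .graph = Iterate T f
  iterate T f .functional = unique
    where
    unique : ∀ {a b b′} → Iterate T f a b → Iterate T f a b′ → b ≡ b′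
    unique (stop _)     (stop _)     = refl
    unique (stop n)     (step t _ _) = ⊥-elim (n t)
    unique (step t _ _) (stop n)     = ⊥-elim (n t)
    unique (step _ x r) (step _ y r′)
      with refl ← functional f x y = unique r r′

C : ∀ {k} → Program k → State k ⇀ State k
C skip        = id⇀
C (j ≔ t)     = total (λ σ → σ [ j ]≔ ⟦ t ⟧ σ)
C (p ⨾ q)     = C p then C q
C (if B p q)  = branch (_⊨ B) (C p) (C q)
C (while B p) = iterate (_⊨ B) (C p)

-- Partial correctness: nothing is required of σ where C p is undefined.

wp : ∀ {k} → Program k → FO k → Pred (State k) 0ℓ
wp p ψ σ = ∀ τ → graph (C p) σ τ → τ ⊨ ψ

-- [ν] = [ν(x₁, …, x_k)]

[_] : ∀ {k} {ℓ} → Pred (Vec ℤ k) ℓ → Pred (State k) ℓ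
[ ν ] σ = ν (⟦ vars ⟧* σ)

#I : ∀ {k} → Program k → ℕ
#I skip        = 0
#I (j ≔ t)     = 0
#I (p ⨾ q)     = suc (#I p + #I q)
#I (if B p q)  = #I p + #I q
#I (while B p) = suc (#I p)

module _ {k P : ℕ} where

  private
    K : Fin P → ℕ
    K _ = k

  -- `I` names the predicate variables introduced by the program; they are
  -- fresh when `I` is injective and its range avoids φ and ψ.

  vc̃ : (p : Program k) → (Fin (#I p) → Fin P) →
       Formula K k → Formula K k → Formula K k
  vc̃ skip        I φ ψ = φ ⇒ ψ
  vc̃ (j ≔ t)     I φ ψ = φ ⇒ ψ [ j ╲ t ]
  vc̃ (p ⨾ q)     I φ ψ =
    vc̃ p (I ∘ suc ∘ (_↑ˡ #I q)) φ (X (I zero) vars) `∧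
    vc̃ q (I ∘ suc ∘ (#I p ↑ʳ_)) (X (I zero) vars) ψ
  vc̃ (if B p q)  I φ ψ =
    vc̃ p (I ∘ (_↑ˡ #I q)) (φ `∧ embed B) ψ `∧
    vc̃ q (I ∘ (#I p ↑ʳ_)) (φ `∧ ∼ embed B) ψ
  vc̃ (while B p) I φ ψ =
    vc̃ p (I ∘ suc) (X (I zero) vars `∧ embed B) (X (I zero) vars) `∧
    (φ ⇒ X (I zero) vars) `∧
    (X (I zero) vars `∧ ∼ embed B ⇒ ψ)

-- The predicate variables of ∃X₀ vc({X₀} p {ψ}) = ∃X₀…Xₙ π are
-- X₀ = X zero and, for the fresh ones, X (suc i) with i : Fin (#I p).

arity : ∀ {k} (p : Program k) → Fin (suc (#I p)) → ℕ
arity {k} p _ = k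

matrix : ∀ {k} (p : Program k) → FO k → Formula (arity p) k
matrix p ψ = vc̃ p suc (X zero vars) (embed ψ)

π : ∀ {k} (p : Program k) → FO k → Formula (arity p) 0
π p ψ = ∀* (matrix p ψ)

module _ {P : ℕ} {ar : Fin P → ℕ} where

  FirstOrder : ∀ {n} → Formula ar n → Set
  FirstOrder (s `= t) = ⊤
  FirstOrder (s `≤ t) = ⊤
  FirstOrder (X i ts) = ⊥
  FirstOrder `⊥       = ⊤
  FirstOrder (A `∧ B) = FirstOrder A × FirstOrder B
  FirstOrder (A ⇒ B)  = FirstOrder A × FirstOrder B
  FirstOrder (`∀ A)   = FirstOrder A

  lower : ∀ {n} (A : Formula ar n) → FirstOrder A → FO n
  lower (s `= t) _       = s `= t
  lower (s `≤ t) _       = s `≤ t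
  lower `⊥       _       = `⊥
  lower (A `∧ B) (a , b) = lower A a `∧ lower B b
  lower (A ⇒ B)  (a , b) = lower A a ⇒ lower B b
  lower (`∀ A)   a       = `∀ lower A a

  embed-FO : ∀ {n} (A : FO n) → FirstOrder (embed A)
  embed-FO (s `= t) = tt
  embed-FO (s `≤ t) = tt
  embed-FO `⊥       = tt
  embed-FO (A `∧ B) = embed-FO A , embed-FO B
  embed-FO (A ⇒ B)  = embed-FO A , embed-FO B
  embed-FO (`∀ A)   = embed-FO A

  subst-FO : ∀ {m n} (σ : Vec (Term n) m) (A : Formula ar m) →
             FirstOrder A → FirstOrder (substᶠ σ A)
  subst-FO σ (s `= t) _       = tt
  subst-FO σ (s `≤ t) _       = tt
  subst-FO σ `⊥       _       = tt
  subst-FO σ (A `∧ B) (a , b) = subst-FO σ A a , subst-FO σ B b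
  subst-FO σ (A ⇒ B)  (a , b) = subst-FO σ A a , subst-FO σ B b
  subst-FO σ (`∀ A)   a       = subst-FO (lift σ) A a

data Premise {P} {ar : Fin P → ℕ} {n} : Formula ar n → Set where
  first-order : ∀ {A} → FirstOrder A → Premise A
  atom        : ∀ {i ts} → Premise (X i ts)
  _∧ˡ_        : ∀ {A B} → Premise A → FirstOrder B → Premise (A `∧ B)
  _∧ʳ_        : ∀ {A B} → FirstOrder A → Premise B → Premise (A `∧ B)

data Conclusion {P} {ar : Fin P → ℕ} {n} : Formula ar n → Set where
  first-order : ∀ {A} → FirstOrder A → Conclusion A
  atom        : ∀ {i ts} → Conclusion (X i ts)

data LinearHorn {P} {ar : Fin P → ℕ} {n} : Formula ar n → Set where
  _∧ʰ_ : ∀ {A B} → LinearHorn A → LinearHorn B → LinearHorn (A `∧ B)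
  _⇒ʰ_ : ∀ {A B} → Premise A → Conclusion B → LinearHorn (A ⇒ B)

Atom : ∀ {P} → (Fin P → ℕ) → ℕ → Set
Atom ar n = Σ[ i ∈ Fin _ ] Vec (Term n) (ar i)

-- `constraint` ∧ ⋀ `body` → `head`, all free variables among `n` shared
-- ones; the head `nothing` is ⊥.

record Clause {P} (ar : Fin P → ℕ) (n : ℕ) : Set where
  constructor clause
  field
    constraint : FO n
    body       : List (Atom ar n)
    head       : Maybe (Atom ar n)

open Clause public using (constraint; body; head)

record LinearClause {P} (ar : Fin P → ℕ) (n : ℕ) : Set where
  constructor linear-clause
  field
    φ′           : FO n
    premise goal : Maybe (Atom ar n)

  toClause : Clause ar n
  toClause = clause φ′ (fromMaybe premise) goal

open LinearClause public using (toClause)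

module _ {P : ℕ} {ar : Fin P → ℕ} {n : ℕ} where

  constraintOf : {A : Formula ar n} → Premise A → FO n
  constraintOf {A} (first-order a)     = lower A a
  constraintOf atom                    = `⊤
  constraintOf {_ `∧ B} (a ∧ˡ b)       = constraintOf a `∧ lower B b
  constraintOf {A `∧ _} (a ∧ʳ b)       = lower A a `∧ constraintOf b

  atomOf : {A : Formula ar n} → Premise A → Maybe (Atom ar n)
  atomOf (first-order _)  = nothing
  atomOf (atom {i} {ts})  = just (i , ts)
  atomOf (a ∧ˡ _)         = atomOf a
  atomOf (_ ∧ʳ b)         = atomOf b

  -- A → θ with θ first-order is read as A ∧ ¬θ → ⊥.

  clauses : {A : Formula ar n} → LinearHorn A → List (LinearClause ar n)
  clauses (a ∧ʰ b) = clauses a List.++ clauses b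
  clauses (_⇒ʰ_ {B = θ} a (first-order b)) =
    linear-clause (constraintOf a `∧ ∼ lower θ b) (atomOf a) nothing ∷ []
  clauses (a ⇒ʰ atom {i} {ts}) =
    linear-clause (constraintOf a) (atomOf a) (just (i , ts)) ∷ []

  -- Replacing every Xᵢ by ¬Xᵢ and contraposing exchanges body and head.

  dual : LinearClause ar n → LinearClause ar n
  dual (linear-clause φ b h) = linear-clause φ h b

record LinearHornSentence {P} {ar : Fin P → ℕ} (A : Formula ar 0) : Set where
  constructor closure
  field
    {#vars}   : ℕ
    {kernel}  : Formula ar #vars
    is-closure : A ≡ ∀* kernel
    is-linear  : LinearHorn kernel

open LinearHornSentence public

infix 10 _ᴰ

_ᴰ : ∀ {P} {ar : Fin P → ℕ} {A : Formula ar 0} →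
     (h : LinearHornSentence A) → List (Clause ar (#vars h))
h ᴰ = List.map (toClause ∘ dual) (clauses (is-linear h))

vc̃-linear : ∀ {k P} (p : Program k) (I : Fin (#I p) → Fin P) {φ ψ} →
            Premise φ → Conclusion ψ → LinearHorn (vc̃ p I φ ψ)
vc̃-linear skip        I a c = a ⇒ʰ c
vc̃-linear (j ≔ t)     I {ψ = ψ} a (first-order c) =
  a ⇒ʰ first-order (subst-FO (vars [ j ]≔ t) ψ c)
vc̃-linear (j ≔ t)     I a atom = a ⇒ʰ atom
vc̃-linear (p ⨾ q)     I a c = vc̃-linear p _ a atom ∧ʰ vc̃-linear q _ atom c
vc̃-linear (if B p q)  I a c =
  vc̃-linear p _ (a ∧ˡ embed-FO B) c ∧ʰ
  vc̃-linear q _ (a ∧ˡ (embed-FO B , tt)) c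
vc̃-linear (while B p) I a c =
  vc̃-linear p _ (atom ∧ˡ embed-FO B) atom ∧ʰ
  ((a ⇒ʰ atom) ∧ʰ ((atom ∧ˡ (embed-FO B , tt)) ⇒ʰ c))

π-linear : ∀ {k} (p : Program k) (ψ : FO k) → LinearHornSentence (π p ψ)
π-linear p ψ =
  closure refl (vc̃-linear p suc atom (first-order (embed-FO ψ)))

-- Among m + l variables, the first m are ȳ and the last l are z̄.

ȳ : ∀ m l → Vec (Term (m + l)) m
ȳ m l = tabulate (λ i → var (i ↑ˡ l))

z̄ : ∀ m l → Vec (Term (m + l)) l
z̄ m l = tabulate (λ i → var (m ↑ʳ i))

module _ {P : ℕ} {ar : Fin P → ℕ} where

  infix 9 _`=*_

  _`=*_ : ∀ {l n} → Vec (Term n) l → Vec (Term n) l → Formula ar n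
  []       `=* []       = `⊤
  (s ∷ ss) `=* (t ∷ ts) = (s `= t) `∧ (ss `=* ts)

module _ {P : ℕ} {ar : Fin P → ℕ} {m : ℕ} where

  headed : ∀ j → Maybe (Atom ar m) → Maybe (Vec (Term m) (ar j))
  headed j nothing = nothing
  headed j (just (i , s)) with i ≟ j
  ... | yes refl = just s
  ... | no  _    = nothing

  disjunct : ∀ j → Clause ar m → Vec (Term m) (ar j) → Formula ar (m + ar j)
  disjunct j c s =
    substᶠ ys (embed (constraint c)) `∧
    foldr (λ (i , t) A → substᶠ ys (X i t) `∧ A)
          (z̄ m (ar j) `=* Vec.map (substᵗ ys) s)
          (body c)
    where ys = ȳ m (ar j)

  -- The disjunction ranges over B_j and Ind_j at once: B_j consists of the
  -- clauses with empty body.  All m variables are bound, occurring or not,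
  -- which is harmless since ℤ is nonempty.

  Φ : List (Clause ar m) → ∀ j → Formula ar (ar j)
  Φ θ j = ∃* m (⋁ (mapMaybe (λ c → Maybe.map (disjunct j c) (headed j (head c))) θ))

module _ {P : ℕ} {ar : Fin P → ℕ} where

  F : (∀ i → Formula ar (ar i)) → Relations ar → Relations ar
  F Φ R i a = R , a ⊨ Φ i

  record IsLeastFixedPoint (G : Relations ar → Relations ar) (L : Relations ar) : Set₁ where
    field
      fixed : ∀ i → G L i ≐ L i
      least : ∀ R → (∀ i → G R i ≐ R i) → ∀ i → L i ⊆ R i

  record LeastFixedPoint (G : Relations ar → Relations ar) : Set₁ where
    field
      relations         : Relations ar
      isLeastFixedPoint : IsLeastFixedPoint G relations

open LeastFixedPoint public

⟦substᵗ⟧ : ∀ {m n} (σ : Vec (Term n) m) t ρ → ⟦ substᵗ σ t ⟧ ρ ≡ ⟦ t ⟧ (⟦ σ ⟧* ρ)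
⟦substᵗ⟧ σ (var i) ρ = sym (lookup-map i _ σ)
⟦substᵗ⟧ σ `0      ρ = refl
⟦substᵗ⟧ σ `1      ρ = refl
⟦substᵗ⟧ σ (s ⊕ t) ρ = cong₂ ℤ._+_ (⟦substᵗ⟧ σ s ρ) (⟦substᵗ⟧ σ t ρ)
⟦substᵗ⟧ σ (s ⊖ t) ρ = cong₂ ℤ._-_ (⟦substᵗ⟧ σ s ρ) (⟦substᵗ⟧ σ t ρ)
⟦substᵗ⟧ σ (s ⊛ t) ρ = cong₂ ℤ._*_ (⟦substᵗ⟧ σ s ρ) (⟦substᵗ⟧ σ t ρ)

⟦substᵗ⟧* : ∀ {l m n} (σ : Vec (Term n) m) (ts : Vec (Term m) l) ρ →
            ⟦ Vec.map (substᵗ σ) ts ⟧* ρ ≡ ⟦ ts ⟧* (⟦ σ ⟧* ρ)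
⟦substᵗ⟧* σ ts ρ =
  trans (sym (map-∘ _ _ ts)) (map-cong (λ t → ⟦substᵗ⟧ σ t ρ) ts)

⟦tabulate⟧* : ∀ {m n} (f : Fin m → Fin n) (ρ : Vec ℤ n) (xs : Vec ℤ m) →
              (∀ i → lookup ρ (f i) ≡ lookup xs i) →
              ⟦ tabulate (var ∘ f) ⟧* ρ ≡ xs
⟦tabulate⟧* f ρ xs eq = trans (sym (tabulate-∘ _ (var ∘ f)))
  (trans (tabulate-cong eq) (tabulate∘lookup xs))

⟦lift⟧* : ∀ {m n} (σ : Vec (Term n) m) a ρ → ⟦ lift σ ⟧* (a ∷ ρ) ≡ a ∷ ⟦ σ ⟧* ρ
⟦lift⟧* σ a ρ = cong (a ∷_) (trans (⟦substᵗ⟧* (tabulate (var ∘ suc)) σ (a ∷ ρ))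
  (cong ⟦ σ ⟧* (⟦tabulate⟧* suc (a ∷ ρ) ρ (λ _ → refl))))

module _ {P : ℕ} {ar : Fin P → ℕ} (R : Relations ar) where

  subst⇒ : ∀ {m n} (σ : Vec (Term n) m) A {ρ} →
           R , ρ ⊨ substᶠ σ A → R , ⟦ σ ⟧* ρ ⊨ A
  subst⇐ : ∀ {m n} (σ : Vec (Term n) m) A {ρ} →
           R , ⟦ σ ⟧* ρ ⊨ A → R , ρ ⊨ substᶠ σ A
  subst⇒ σ (s `= t) = subst₂ _≡_ (⟦substᵗ⟧ σ s _) (⟦substᵗ⟧ σ t _)
  subst⇒ σ (s `≤ t) = subst₂ ℤ._≤_ (⟦substᵗ⟧ σ s _) (⟦substᵗ⟧ σ t _)
  subst⇒ σ (X i ts) = subst (R i) (⟦substᵗ⟧* σ ts _)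
  subst⇒ σ `⊥ h = h
  subst⇒ σ (A `∧ B) (a , b) = subst⇒ σ A a , subst⇒ σ B b
  subst⇒ σ (A ⇒ B) h a = subst⇒ σ B (h (subst⇐ σ A a))
  subst⇒ σ (`∀ A) h a =
    subst (λ ρ → R , ρ ⊨ A) (⟦lift⟧* σ a _) (subst⇒ (lift σ) A (h a))
  subst⇐ σ (s `= t) = subst₂ _≡_ (sym (⟦substᵗ⟧ σ s _)) (sym (⟦substᵗ⟧ σ t _))
  subst⇐ σ (s `≤ t) = subst₂ ℤ._≤_ (sym (⟦substᵗ⟧ σ s _)) (sym (⟦substᵗ⟧ σ t _))
  subst⇐ σ (X i ts) = subst (R i) (sym (⟦substᵗ⟧* σ ts _))
  subst⇐ σ `⊥ h = h
  subst⇐ σ (A `∧ B) (a , b) = subst⇐ σ A a , subst⇐ σ B b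
  subst⇐ σ (A ⇒ B) h a = subst⇐ σ B (h (subst⇒ σ A a))
  subst⇐ σ (`∀ A) h a =
    subst⇐ (lift σ) A (subst (λ ρ → R , ρ ⊨ A) (sym (⟦lift⟧* σ a _)) (h a))

  embed⇒ : ∀ {n} (A : FO n) {ρ} → R , ρ ⊨ embed A → ρ ⊨ A
  embed⇐ : ∀ {n} (A : FO n) {ρ} → ρ ⊨ A → R , ρ ⊨ embed A
  embed⇒ (s `= t) h = h
  embed⇒ (s `≤ t) h = h
  embed⇒ `⊥ h = h
  embed⇒ (A `∧ B) (a , b) = embed⇒ A a , embed⇒ B b
  embed⇒ (A ⇒ B) h a = embed⇒ B (h (embed⇐ A a))
  embed⇒ (`∀ A) h a = embed⇒ A (h a)
  embed⇐ (s `= t) h = h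
  embed⇐ (s `≤ t) h = h
  embed⇐ `⊥ h = h
  embed⇐ (A `∧ B) (a , b) = embed⇐ A a , embed⇐ B b
  embed⇐ (A ⇒ B) h a = embed⇐ B (h (embed⇒ A a))
  embed⇐ (`∀ A) h a = embed⇐ A (h a)

  ∃*-intro : ∀ {m n} {A : Formula ar (m + n)} (ys : Vec ℤ m) {ρ} →
             R , ys ++ ρ ⊨ A → R , ρ ⊨ ∃* m A
  ∃*-intro []       h = h
  ∃*-intro (y ∷ ys) h = ∃*-intro ys (λ n → n y h)

  ∃*-elim : ∀ m {n} {A : Formula ar (m + n)} {ρ} → R , ρ ⊨ ∃* m A →
            ¬ (∀ (ys : Vec ℤ m) → ¬ (R , ys ++ ρ ⊨ A))
  ∃*-elim zero    h n = n [] h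
  ∃*-elim (suc m) h n = ∃*-elim m h (λ ys k → k (λ y → n (y ∷ ys)))

  ⋁-intro : ∀ {n} {T : Set} {f : T → Maybe (Formula ar n)} {xs x A ρ} →
            x ∈ xs → f x ≡ just A → R , ρ ⊨ A → R , ρ ⊨ ⋁ (mapMaybe f xs)
  ⋁-intro {f = f} {xs = x ∷ xs} (here refl) eq h with f x | eq
  ... | just _ | refl = λ (n , _) → n h
  ⋁-intro {f = f} {xs = y ∷ xs} (there x∈) eq h with f y
  ... | just _  = λ (_ , n) → n (⋁-intro {f = f} x∈ eq h)
  ... | nothing = ⋁-intro {f = f} x∈ eq h

  ⋁-elim : ∀ {n} {T : Set} {f : T → Maybe (Formula ar n)} xs {ρ} →
           R , ρ ⊨ ⋁ (mapMaybe f xs) →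
           ¬ (∀ {x A} → x ∈ xs → f x ≡ just A → ¬ (R , ρ ⊨ A))
  ⋁-elim []               h n = h
  ⋁-elim {f = f} (x ∷ xs) h n with f x in eq
  ... | just _  = h (n (here refl) eq , λ h′ → ⋁-elim {f = f} xs h′ (n ∘ there))
  ... | nothing = ⋁-elim {f = f} xs h (n ∘ there)

  =*⇒ : ∀ {l n} (ss ts : Vec (Term n) l) {ρ} →
        R , ρ ⊨ ss `=* ts → ⟦ ss ⟧* ρ ≡ ⟦ ts ⟧* ρ
  =*⇒ []       []       _       = refl
  =*⇒ (_ ∷ ss) (_ ∷ ts) (e , h) = cong₂ _∷_ e (=*⇒ ss ts h)

  =*⇐ : ∀ {l n} (ss ts : Vec (Term n) l) {ρ} →
        ⟦ ss ⟧* ρ ≡ ⟦ ts ⟧* ρ → R , ρ ⊨ ss `=* ts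
  =*⇐ []       []       _ = λ z → z
  =*⇐ (_ ∷ ss) (_ ∷ ts) e = cong Vec.head e , =*⇐ ss ts (cong Vec.tail e)

  foldr⇒ : ∀ {n} {T : Set} {f : T → Formula ar n} {B} xs {ρ} →
           R , ρ ⊨ foldr (λ x A → f x `∧ A) B xs →
           All (λ x → R , ρ ⊨ f x) xs × (R , ρ ⊨ B)
  foldr⇒ []       h       = [] , h
  foldr⇒ (x ∷ xs) (a , h) = let as , b = foldr⇒ xs h in a ∷ as , b

  foldr⇐ : ∀ {n} {T : Set} {f : T → Formula ar n} {B xs ρ} →
           All (λ x → R , ρ ⊨ f x) xs → R , ρ ⊨ B →
           R , ρ ⊨ foldr (λ x A → f x `∧ A) B xs
  foldr⇐ []       b = b
  foldr⇐ (a ∷ as) b = a , foldr⇐ as b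

  module _ {m : ℕ} {j : Fin P} (ys : Vec ℤ m) (zs : Vec ℤ (ar j)) where

    private
      Y = ȳ m (ar j)
      Z = z̄ m (ar j)

    ⟦ȳ⟧ : ⟦ Y ⟧* (ys ++ zs) ≡ ys
    ⟦ȳ⟧ = ⟦tabulate⟧* (_↑ˡ ar j) (ys ++ zs) ys (lookup-++ˡ ys zs)

    ⟦z̄⟧ : ⟦ Z ⟧* (ys ++ zs) ≡ zs
    ⟦z̄⟧ = ⟦tabulate⟧* (m ↑ʳ_) (ys ++ zs) zs (lookup-++ʳ ys zs)

    disjunct⇒ : ∀ c {s} → R , ys ++ zs ⊨ disjunct j c s →
                (ys ⊨ constraint c) ×
                All (λ (i , t) → R i (⟦ t ⟧* ys)) (body c) ×
                zs ≡ ⟦ s ⟧* ys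
    disjunct⇒ c {s} (h , h′) =
      let as , e = foldr⇒ (body c) h′ in
      embed⇒ (constraint c) (subst (λ ρ → R , ρ ⊨ embed (constraint c)) ⟦ȳ⟧
        (subst⇒ Y (embed (constraint c)) h)) ,
      All.map (λ {(i , t)} a → subst (λ ρ → R i (⟦ t ⟧* ρ)) ⟦ȳ⟧
        (subst⇒ Y (X i t) a)) as ,
      trans (sym ⟦z̄⟧) (trans (=*⇒ Z (Vec.map (substᵗ Y) s) e)
        (trans (⟦substᵗ⟧* Y s _) (cong ⟦ s ⟧* ⟦ȳ⟧)))

    disjunct⇐ : ∀ c {s} → ys ⊨ constraint c →
                All (λ (i , t) → R i (⟦ t ⟧* ys)) (body c) →
                zs ≡ ⟦ s ⟧* ys →
                R , ys ++ zs ⊨ disjunct j c s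
    disjunct⇐ c {s} h as e =
      subst⇐ Y (embed (constraint c))
        (subst (λ ρ → R , ρ ⊨ embed (constraint c)) (sym ⟦ȳ⟧)
          (embed⇐ (constraint c) h)) ,
      foldr⇐ (All.map (λ {(i , t)} a → subst⇐ Y (X i t)
               (subst (λ ρ → R i (⟦ t ⟧* ρ)) (sym ⟦ȳ⟧) a)) as)
        (=*⇐ Z (Vec.map (substᵗ Y) s) (trans ⟦z̄⟧ (trans e
          (sym (trans (⟦substᵗ⟧* Y s _) (cong ⟦ s ⟧* ⟦ȳ⟧))))))

-- Existence of the least fixed point of F (Φ θ).  Knaster–Tarski is not
-- available predicatively; instead the fixed point is built from the tuples
-- derivable from θ.  The double negation matches the classical ∃ and ∨ in Φ.

module _ {P : ℕ} {ar : Fin P → ℕ} {m : ℕ} (θ : List (Clause ar m)) where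

  data Derivable : Relations ar where
    derive : ∀ {j c s} → c ∈ θ → headed j (head c) ≡ just s →
             (ys : Vec ℤ m) → ys ⊨ constraint c →
             All (λ a → Derivable (proj₁ a) (⟦ proj₂ a ⟧* ys)) (body c) →
             Derivable j (⟦ s ⟧* ys)

  F-intro : ∀ {R j c s} → c ∈ θ → headed j (head c) ≡ just s →
            (ys : Vec ℤ m) → ys ⊨ constraint c →
            All (λ a → R (proj₁ a) (⟦ proj₂ a ⟧* ys)) (body c) →
            F (Φ θ) R j (⟦ s ⟧* ys)
  F-intro {R} {j} {c} {s} c∈ eq ys h as =
    ∃*-intro R ys (⋁-intro R c∈ (cong (Maybe.map (disjunct j c)) eq)
      (disjunct⇐ R ys (⟦ s ⟧* ys) c h as refl))

  F-elim : ∀ {R j zs} → F (Φ θ) R j zs →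
           ¬ (∀ {c s} → c ∈ θ → headed j (head c) ≡ just s →
              (ys : Vec ℤ m) → ys ⊨ constraint c →
              All (λ a → R (proj₁ a) (⟦ proj₂ a ⟧* ys)) (body c) →
              ¬ (zs ≡ ⟦ s ⟧* ys))
  F-elim {R} {j} {zs} h n =
    ∃*-elim R m h λ ys h′ → ⋁-elim R θ h′ λ {c} c∈ eq d → case c c∈ eq ys d
    where
    case : ∀ c {A} → c ∈ θ → Maybe.map (disjunct j c) (headed j (head c)) ≡ just A →
           ∀ ys → ¬ (R , ys ++ zs ⊨ A)
    case c c∈ eq ys d with headed j (head c) in eq′
    case c c∈ refl ys d | just s =
      let h , as , e = disjunct⇒ R ys zs c d in n c∈ eq′ ys h as e

  ¬¬-All : ∀ {A : Set} {Q : Pred A 0ℓ} {xs} → All (λ x → ¬ ¬ Q x) xs → ¬ ¬ All Q xs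
  ¬¬-All []       k = k []
  ¬¬-All (q ∷ qs) k = q (λ q → ¬¬-All qs (λ qs → k (q ∷ qs)))

  lfp : LeastFixedPoint (F (Φ θ))
  lfp = record
    { relations         = L
    ; isLeastFixedPoint = record
      { fixed = λ i → F⊆L , L⊆F
      ; least = λ R fix i nn → proj₁ (fix i) (F-stable (λ n → nn (λ d → n (D⊆F fix d))))
      }
    }
    where
    L : Relations ar
    L j a = ¬ ¬ Derivable j a

    F-stable : ∀ {R j a} → ¬ ¬ F (Φ θ) R j a → F (Φ θ) R j a
    F-stable {R} = go m (⋁-stable (mapMaybe _ θ))
      where
      Stable : ∀ {n} → Formula ar n → Set
      Stable A = ∀ {ρ} → ¬ ¬ (R , ρ ⊨ A) → R , ρ ⊨ A

      ⋁-stable : ∀ {n} (As : List (Formula ar n)) → Stable (⋁ As)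
      ⋁-stable []      nn   = nn (λ z → z)
      ⋁-stable (_ ∷ _) nn x = nn (λ f → f x)

      go : ∀ m′ {n} {A : Formula ar (m′ + n)} → Stable A → Stable (∃* m′ A)
      go zero     st = st
      go (suc m′) st = go m′ (λ nn x → nn (λ f → f x))

    F⊆L : ∀ {j a} → F (Φ θ) L j a → L j a
    F⊆L h n = F-elim h λ {c} c∈ eq ys g as e →
      ¬¬-All as (λ as → n (subst (Derivable _) (sym e) (derive {c = c} c∈ eq ys g as)))

    D⊆F : ∀ {R} → (∀ i → F (Φ θ) R i ≐ R i) → ∀ {j a} → Derivable j a → F (Φ θ) R j a
    D⊆F {R} fix = D⊆
      where
      D⊆  : ∀ {j a} → Derivable j a → F (Φ θ) R j a
      D⊆* : ∀ {as} {ys : Vec ℤ m} →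
            All (λ a → Derivable (proj₁ a) (⟦ proj₂ a ⟧* ys)) as →
            All (λ a → R (proj₁ a) (⟦ proj₂ a ⟧* ys)) as
      D⊆ (derive c∈ eq ys g as) = F-intro c∈ eq ys g (D⊆* as)
      D⊆* []       = []
      D⊆* (d ∷ ds) = proj₁ (fix _) (D⊆ d) ∷ D⊆* ds

    L⊆F : ∀ {j a} → L j a → F (Φ θ) L j a
    L⊆F nn = F-stable λ n → nn λ where
      (derive c∈ eq ys g as) → n (F-intro c∈ eq ys g (All.map (λ d k → k d) as))

{-# OPTIONS --safe #-}

-- A family R of predicates satisfies π exactly when it avoids every tuple
-- derivable from π^D.  Hence the complement of the least fixed point is the
-- weakest solution of π.  It is contained in wp because every solution of a
-- verification condition is a family of sound assertions, and it contains wp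
-- because the weakest preconditions at the program points form a solution.

module Submission where

open import Defs
open import Data.Empty using (⊥-elim)
open import Data.Fin.Base using (Fin; zero; suc; splitAt)
open import Data.Fin.Properties using (_≟_; splitAt-↑ˡ; splitAt-↑ʳ)
import Data.Integer.Properties as ℤ
open import Data.Integer.Base using (ℤ)
open import Data.List.Base using (List; map)
open import Data.List.Membership.Propositional using (_∈_)
open import Data.List.Membership.Propositional.Properties using (∈-map⁺; ∈-map⁻)
open import Data.List.Relation.Unary.All as All using (All; []; _∷_)
open import Data.List.Relation.Unary.All.Properties using (++⁺; ++⁻ˡ; ++⁻ʳ)
open import Data.Maybe using (Maybe; just; nothing; Is-just)
import Data.Maybe.Relation.Unary.All as Maybeᴬ
import Data.Maybe.Relation.Unary.Any as Maybeᴱ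
open import Data.Nat.Base using (ℕ)
open import Data.Product.Base using (_×_; _,_; proj₁; proj₂)
open import Data.Sum.Base using ([_,_]′)
open import Data.Unit.Base using (tt)
open import Data.Vec.Base using (Vec; _[_]≔_)
open import Data.Vec.Properties using (map-[]≔)
open import Function.Base using (_∘_; id)
open import Level using (0ℓ)
open import Relation.Binary.PropositionalEquality
  using (_≡_; refl; sym; trans; cong; subst)
open import Relation.Nullary using (¬_; yes; no)
open import Relation.Nullary.Decidable using (decidable-stable)
open import Relation.Nullary.Negation using (Stable)
open import Relation.Unary using (Pred; _≐_; ∁)

open LinearClause using (φ′; premise; goal)

-- Stability of first-order formulas and evaluation of program variables.

⊨-stable : ∀ {n} (A : FO n) {ρ} → Stable (ρ ⊨ A)
⊨-stable (s `= t) = decidable-stable (_ ℤ.≟ _)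
⊨-stable (s `≤ t) = decidable-stable (_ ℤ.≤? _)
⊨-stable `⊥       = λ ¬¬⊥ → ¬¬⊥ id
⊨-stable (A `∧ B) = λ ¬¬h →
  ⊨-stable A (λ ¬a → ¬¬h (¬a ∘ proj₁)) , ⊨-stable B (λ ¬b → ¬¬h (¬b ∘ proj₂))
⊨-stable (A ⇒ B)  = λ ¬¬h a → ⊨-stable B (λ ¬b → ¬¬h (λ h → ¬b (h a)))
⊨-stable (`∀ A)   = λ ¬¬h a → ⊨-stable A (λ ¬b → ¬¬h (λ h → ¬b (h a)))

⟦vars⟧* : ∀ {n} (ρ : Vec ℤ n) → ⟦ vars ⟧* ρ ≡ ρ
⟦vars⟧* ρ = ⟦tabulate⟧* id ρ ρ (λ _ → refl)

-- Matches the syntactic substitution in the assignment clause of `vc̃` with the state update in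
-- `C`.
⟦vars[]≔⟧* : ∀ {n} (j : Fin n) t (ρ : Vec ℤ n) →
             ⟦ vars [ j ]≔ t ⟧* ρ ≡ ρ [ j ]≔ ⟦ t ⟧ ρ
⟦vars[]≔⟧* j t ρ = trans (map-[]≔ _ vars j) (cong (_[ j ]≔ ⟦ t ⟧ ρ) (⟦vars⟧* ρ))

-- Linear Horn formulas and their clauses.

module _ {P : ℕ} {ar : Fin P → ℕ} (R : Relations ar) where

  lower⇒ : ∀ {n} (A : Formula ar n) a {ρ} → R , ρ ⊨ A → ρ ⊨ lower A a
  lower⇐ : ∀ {n} (A : Formula ar n) a {ρ} → ρ ⊨ lower A a → R , ρ ⊨ A
  lower⇒ (s `= t) _ h = h
  lower⇒ (s `≤ t) _ h = h
  lower⇒ `⊥ _ h = h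
  lower⇒ (A `∧ B) (a , b) (h , h′) = lower⇒ A a h , lower⇒ B b h′
  lower⇒ (A ⇒ B) (a , b) h h′ = lower⇒ B b (h (lower⇐ A a h′))
  lower⇒ (`∀ A) a h x = lower⇒ A a (h x)
  lower⇐ (s `= t) _ h = h
  lower⇐ (s `≤ t) _ h = h
  lower⇐ `⊥ _ h = h
  lower⇐ (A `∧ B) (a , b) (h , h′) = lower⇐ A a h , lower⇐ B b h′
  lower⇐ (A ⇒ B) (a , b) h h′ = lower⇐ B b (h (lower⇒ A a h′))
  lower⇐ (`∀ A) a h x = lower⇐ A a (h x)

  module _ {n : ℕ} (ρ : Vec ℤ n) where

    AtomHolds : Pred (Atom ar n) 0ℓ
    AtomHolds (i , ts) = R i (⟦ ts ⟧* ρ)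

    -- The double negation makes a clause constructively equivalent to its contrapositive, which is
    -- how the dual clause reads it. For the goal `nothing` the conclusion is falsity.
    Satisfies : Pred (LinearClause ar n) 0ℓ
    Satisfies c = ρ ⊨ φ′ c → Maybeᴬ.All AtomHolds (premise c) →
                  ¬ ¬ Maybeᴱ.Any AtomHolds (goal c)

    premise⇒ : {A : Formula ar n} (a : Premise A) → R , ρ ⊨ A →
               (ρ ⊨ constraintOf a) × Maybeᴬ.All AtomHolds (atomOf a)
    premise⇒ {A} (first-order a)   h        = lower⇒ A a h , Maybeᴬ.nothing
    premise⇒ atom                  h        = id , Maybeᴬ.just h
    premise⇒ {_ `∧ B} (a ∧ˡ b)     (h , h′) =
      let g , at = premise⇒ a h in (g , lower⇒ B b h′) , at
    premise⇒ {A `∧ _} (a ∧ʳ b)     (h , h′) =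
      let g , at = premise⇒ b h′ in (lower⇒ A a h , g) , at

    premise⇐ : {A : Formula ar n} (a : Premise A) → ρ ⊨ constraintOf a →
               Maybeᴬ.All AtomHolds (atomOf a) → R , ρ ⊨ A
    premise⇐ {A} (first-order a)   h        at               = lower⇐ A a h
    premise⇐ atom                  h        (Maybeᴬ.just at) = at
    premise⇐ {_ `∧ B} (a ∧ˡ b)     (h , h′) at = premise⇐ a h at , lower⇐ B b h′
    premise⇐ {A `∧ _} (a ∧ʳ b)     (h , h′) at = lower⇐ A a h , premise⇐ b h′ at

    clauses⇒ : {A : Formula ar n} (h : LinearHorn A) → R , ρ ⊨ A →
               All Satisfies (clauses h)
    clauses⇒ (h ∧ʰ h′) (x , y) = ++⁺ (clauses⇒ h x) (clauses⇒ h′ y)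
    clauses⇒ (_⇒ʰ_ {B = θ} a (first-order b)) x =
      (λ (g , ¬θ) at _ → ¬θ (lower⇒ θ b (x (premise⇐ a g at)))) ∷ []
    clauses⇒ (a ⇒ʰ atom) x =
      (λ g at ¬goal → ¬goal (Maybeᴱ.just (x (premise⇐ a g at)))) ∷ []

    -- Stability removes the double negation in `Satisfies`: for atoms it is assumed, for
    -- first-order conclusions it is `⊨-stable`.
    clauses⇐ : (∀ i {a} → Stable (R i a)) → {A : Formula ar n} (h : LinearHorn A) →
               All Satisfies (clauses h) → R , ρ ⊨ A
    clauses⇐ st (h ∧ʰ h′) sat =
      clauses⇐ st h (++⁻ˡ (clauses h) sat) , clauses⇐ st h′ (++⁻ʳ (clauses h) sat)
    clauses⇐ st (_⇒ʰ_ {B = θ} a (first-order b)) (sat ∷ []) x =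
      let g , at = premise⇒ a x in
      lower⇐ θ b (⊨-stable (lower θ b) λ ¬θ → sat (g , ¬θ) at λ ())
    clauses⇐ st (a ⇒ʰ atom {i}) (sat ∷ []) x =
      let g , at = premise⇒ a x in
      st i λ ¬goal → sat g at λ { (Maybeᴱ.just y) → ¬goal y }

-- Solutions and derivability from the dual clauses.

module _ {P : ℕ} {ar : Fin P → ℕ} {m : ℕ} where

  headed⇒ : ∀ {j} (h : Maybe (Atom ar m)) {s} → headed j h ≡ just s → h ≡ just (j , s)
  headed⇒ {j} (just (i , _)) eq with i ≟ j
  headed⇒ {j} (just (i , _)) refl | yes refl = refl

  headed⇐ : ∀ j {s} → headed {ar = ar} {m = m} j (just (j , s)) ≡ just s
  headed⇐ j with j ≟ j
  ... | yes refl = refl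
  ... | no  j≢j  = ⊥-elim (j≢j refl)

  Dual : List (LinearClause ar m) → List (Clause ar m)
  Dual = map (toClause ∘ dual)

  -- Induction on the derivation. If `R` held at the derived tuple, the original clause would, up to
  -- double negation, pass it on to its goal; that goal is either falsity or a tuple derived
  -- earlier, where `R` already fails.
  derivable⇒¬ : ∀ R {cs} → (∀ ρ → All (Satisfies R ρ) cs) →
                ∀ {i a} → Derivable (Dual cs) i a → ¬ R i a
  derivable⇒¬ R sat (derive c∈ eq ys g ds) r with ∈-map⁻ (toClause ∘ dual) c∈
  -- The head of the dual is the premise of the original clause, so `r` supplies that premise.
  ... | linear-clause φ b h , lc∈ , refl with refl ← headed⇒ b eq
    = All.lookup (sat ys) lc∈ g (Maybeᴬ.just r) (refute h ds)
    where
    refute : ∀ h → All (λ a → Derivable (Dual _) (proj₁ a) (⟦ proj₂ a ⟧* ys))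
                       (body (toClause (dual (linear-clause φ b h)))) →
             ¬ Maybeᴱ.Any (AtomHolds R ys) h
    refute (just _) (d ∷ []) (Maybeᴱ.just r′) = derivable⇒¬ R sat d r′

  -- Clauses without a premise atom are excluded: their duals have head ⊥ and
  -- so do not contribute to the least fixed point.

  ∁derivable-satisfies : ∀ {cs} → All (Is-just ∘ premise) cs →
                         ∀ ρ → All (Satisfies (λ i → ∁ (Derivable (Dual cs) i)) ρ) cs
  ∁derivable-satisfies {cs} guarded ρ =
    All.tabulate λ {c} c∈ → sat c c∈ (All.lookup guarded c∈)
    where
    sat : ∀ c → c ∈ cs → Is-just (premise c) →
          Satisfies (λ i → ∁ (Derivable (Dual cs) i)) ρ c
    sat (linear-clause _ (just (j , _)) nothing) c∈ _ g (Maybeᴬ.just ¬d) _ =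
      ¬d (derive (∈-map⁺ (toClause ∘ dual) c∈) (headed⇐ j) ρ g [])
    sat (linear-clause _ (just (j , _)) (just _)) c∈ _ g (Maybeᴬ.just ¬d) ¬goal =
      ¬goal (Maybeᴱ.just λ d →
        ¬d (derive (∈-map⁺ (toClause ∘ dual) c∈) (headed⇐ j) ρ g (d ∷ [])))

-- Solutions of a verification condition are sound assertions.

module _ {k P : ℕ} where

  private
    K : Fin P → ℕ
    K _ = k

  -- Each premise generated is the given one or an atom of a fresh variable, possibly strengthened
  -- by tests, so `∁derivable-satisfies` applies to `π`, whose initial premise is the atom of
  -- `X zero`.
  vc̃-guarded : ∀ (p : Program k) I {φ ψ : Formula K k} (a : Premise φ) (c : Conclusion ψ) →
               Is-just (atomOf a) → All (Is-just ∘ premise) (clauses (vc̃-linear p I a c))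
  vc̃-guarded skip        I a (first-order _) j = j ∷ []
  vc̃-guarded skip        I a atom            j = j ∷ []
  vc̃-guarded (_ ≔ _)     I a (first-order _) j = j ∷ []
  vc̃-guarded (_ ≔ _)     I a atom            j = j ∷ []
  vc̃-guarded (p ⨾ q)     I a c j =
    ++⁺ (vc̃-guarded p _ a atom j) (vc̃-guarded q _ atom c (Maybeᴱ.just tt))
  vc̃-guarded (if B p q)  I a c j =
    ++⁺ (vc̃-guarded p _ (a ∧ˡ embed-FO B) c j)
        (vc̃-guarded q _ (a ∧ˡ (embed-FO B , tt)) c j)
  vc̃-guarded (while B p) I a c j =
    ++⁺ (vc̃-guarded p _ (atom ∧ˡ embed-FO B) atom (Maybeᴱ.just tt))
        (j ∷ exit c)
    where
    exit : ∀ {ψ} (c : Conclusion ψ) → All (Is-just ∘ premise)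
             (clauses ((atom {ts = vars} ∧ˡ (embed-FO B , tt)) ⇒ʰ c))
    exit (first-order _) = Maybeᴱ.just tt ∷ []
    exit atom            = Maybeᴱ.just tt ∷ []

  -- The condition is assumed at every valuation because a run passes through states other than its
  -- initial one.
  vc̃-sound : ∀ (R : Relations K) (p : Program k) I φ ψ →
             (∀ ρ → R , ρ ⊨ vc̃ p I φ ψ) →
             ∀ {σ τ} → R , σ ⊨ φ → graph (C p) σ τ → R , τ ⊨ ψ
  vc̃-sound R skip I φ ψ vc {σ} x refl = vc σ x
  vc̃-sound R (j ≔ t) I φ ψ vc {σ} x refl =
    subst (λ ρ → R , ρ ⊨ ψ) (⟦vars[]≔⟧* j t σ) (subst⇒ R (vars [ j ]≔ t) ψ (vc σ x))
  vc̃-sound R (p ⨾ q) I φ ψ vc x (_ , px , qx) =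
    vc̃-sound R q _ _ ψ (proj₂ ∘ vc) (vc̃-sound R p _ φ _ (proj₁ ∘ vc) x px) qx
  vc̃-sound R (if B p q) I φ ψ vc x (true b r) =
    vc̃-sound R p _ _ ψ (proj₁ ∘ vc) (x , embed⇐ R B b) r
  vc̃-sound R (if B p q) I φ ψ vc {σ} x (false ¬b r) =
    vc̃-sound R q _ _ ψ (proj₂ ∘ vc) (x , ¬b ∘ embed⇒ R B {σ}) r
  vc̃-sound R (while B {qf} p) I φ ψ vc {σ} x r = loop (proj₁ (proj₂ (vc σ)) x) r
    where
    -- Induction on the iterations: the body's condition restores the invariant, and the exit
    -- condition yields `ψ`.
    loop : ∀ {σ τ} → R , σ ⊨ X (I zero) vars → graph (C (while B {qf} p)) σ τ → R , τ ⊨ ψ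
    loop {σ} i (stop ¬b) = proj₂ (proj₂ (vc σ)) (i , ¬b ∘ embed⇒ R B {σ})
    loop i (step b s r)  = loop (vc̃-sound R p _ _ _ (proj₁ ∘ vc) (i , embed⇐ R B b) s) r

-- Weakest preconditions solve the verification condition.

-- The postcondition is a semantic predicate, since those at intermediate points are themselves
-- weakest preconditions.
WP : ∀ {k} → Program k → Pred (State k) 0ℓ → Pred (State k) 0ℓ
WP p Q σ = ∀ τ → graph (C p) σ τ → Q τ

-- A loop's invariant is the weakest precondition of the whole loop, which is also the postcondition
-- of its body. `splitAt` undoes the numbering of fresh variables in `vc̃`.
assertions : ∀ {k} (p : Program k) → Pred (State k) 0ℓ → Fin (#I p) → Pred (State k) 0ℓ
assertions (p ⨾ q)     Q zero    = WP q Q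
assertions (p ⨾ q)     Q (suc i) =
  [ assertions p (WP q Q) , assertions q Q ]′ (splitAt (#I p) i)
assertions (if B p q)  Q i       = [ assertions p Q , assertions q Q ]′ (splitAt (#I p) i)
assertions w@(while _ p) Q zero    = WP w Q
assertions w@(while _ p) Q (suc i) = assertions p (WP w Q) i

module _ {k P : ℕ} where

  private
    K : Fin P → ℕ
    K _ = k

  -- `φ` and `ψ` are tied to `Q` only by implications, so the induction hypothesis covers
  -- preconditions strengthened by tests.
  vc̃-complete : ∀ (R : Relations K) (p : Program k) I φ ψ Q →
                (∀ i → R (I i) ≡ assertions p Q i) →
                (∀ {ρ} → R , ρ ⊨ φ → WP p Q ρ) →
                (∀ {ρ} → Q ρ → R , ρ ⊨ ψ) →
                ∀ ρ → R , ρ ⊨ vc̃ p I φ ψ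
  vc̃-complete R skip I φ ψ Q eq pre post ρ x = post (pre x ρ refl)
  vc̃-complete R (j ≔ t) I φ ψ Q eq pre post ρ x =
    subst⇐ R (vars [ j ]≔ t) ψ (subst (λ ρ → R , ρ ⊨ ψ) (sym (⟦vars[]≔⟧* j t ρ))
      (post (pre x _ refl)))
  vc̃-complete R (p ⨾ q) I φ ψ Q eq pre post ρ =
    vc̃-complete R p _ φ _ (WP q Q)
      (λ i → trans (eq _) (cong [ _ , _ ]′ (splitAt-↑ˡ _ i (#I q))))
      (λ x s sp t tq → pre x t (s , sp , tq))
      (λ {ρ} x → subst id (sym (at ρ)) x) ρ ,
    vc̃-complete R q _ _ ψ Q
      (λ i → trans (eq _) (cong [ _ , _ ]′ (splitAt-↑ʳ (#I p) _ i)))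
      (λ {ρ} x → subst id (at ρ) x) post ρ
    where
    -- The atom is evaluated at `⟦ vars ⟧* ρ`, which equals `ρ` only propositionally.
    at : ∀ ρ → R (I zero) (⟦ vars ⟧* ρ) ≡ WP q Q ρ
    at ρ rewrite eq zero | ⟦vars⟧* ρ = refl
  vc̃-complete R (if B p q) I φ ψ Q eq pre post ρ =
    vc̃-complete R p _ _ ψ Q
      (λ i → trans (eq _) (cong [ _ , _ ]′ (splitAt-↑ˡ _ i (#I q))))
      (λ (x , b) t r → pre x t (true (embed⇒ R B b) r)) post ρ ,
    vc̃-complete R q _ _ ψ Q
      (λ i → trans (eq _) (cong [ _ , _ ]′ (splitAt-↑ʳ (#I p) _ i)))
      (λ {ρ} (x , ¬b) t r → pre x t (false (¬b ∘ embed⇐ R B {ρ}) r)) post ρ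
  vc̃-complete R w@(while B p) I φ ψ Q eq pre post ρ =
    vc̃-complete R p _ _ _ (WP w Q) (eq ∘ suc)
      -- A run of the body under the test, followed by a run of the loop, is again a run of the
      -- loop.
      (λ {ρ} (x , b) s sp t r → subst id (at ρ) x t (step (embed⇒ R B b) sp r))
      (λ {ρ} x → subst id (sym (at ρ)) x) ρ ,
    (λ x → subst id (sym (at ρ)) (pre x)) ,
    (λ (x , ¬b) → post (subst id (at ρ) x ρ (stop (¬b ∘ embed⇐ R B {ρ}))))
    where
    at : ∀ ρ → R (I zero) (⟦ vars ⟧* ρ) ≡ WP w Q ρ
    at ρ rewrite eq zero | ⟦vars⟧* ρ = refl

corollary19 : ∀ {k} (p : Program k) (ψ : FO k) →
    let ν = ∁ (relations (lfp (π-linear p ψ ᴰ)) zero)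
    in [ ν ] ≐ wp p ψ
corollary19 {k} p ψ = ν⊆wp , wp⊆ν
  where
  horn = is-linear (π-linear p ψ)
  D    = Derivable (π-linear p ψ ᴰ)

  -- The least fixed point is the double negation of `D`, so its complement, a triple negation, is
  -- equivalent to `N`; as a negation, `N` is stable.
  N : Relations (arity p)
  N i = ∁ (D i)

  ν⊆wp : ∀ {σ} → ¬ ¬ ¬ D zero (⟦ vars ⟧* σ) → wp p ψ σ
  ν⊆wp ¬¬¬d τ r = embed⇒ N ψ
    (vc̃-sound N p suc (X zero vars) (embed ψ)
      (λ ρ → clauses⇐ N ρ (λ _ ¬¬n d → ¬¬n (λ n → n d)) horn
        (∁derivable-satisfies
          (vc̃-guarded p suc atom (first-order (embed-FO ψ)) (Maybeᴱ.just tt)) ρ))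
      (λ d → ¬¬¬d (λ ¬d → ¬d d)) r)

  -- Choosing `wp p ψ` for `X zero` makes the precondition hypothesis of `vc̃-complete` immediate.
  R : Relations (arity p)
  R zero    = wp p ψ
  R (suc i) = assertions p (_⊨ ψ) i

  wp⊆ν : ∀ {σ} → wp p ψ σ → ¬ ¬ ¬ D zero (⟦ vars ⟧* σ)
  wp⊆ν {σ} w ¬¬d = ¬¬d λ d → derivable⇒¬ R
    (λ ρ → clauses⇒ R ρ horn
      (vc̃-complete R p suc (X zero vars) (embed ψ) (_⊨ ψ) (λ _ → refl)
        (λ {ρ} → subst (wp p ψ) (⟦vars⟧* ρ)) (λ {ρ} → embed⇐ R ψ) ρ))
    d (subst (wp p ψ) (sym (⟦vars⟧* σ)) w)
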